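{- Let $G=(V,E)$ be an $n$-vertex graph and let $t\geq 2$ be an integer. In the iterative sparsification process on $(G,t)$ (defined in the context), with exponentially high probability, for every $i\in[t]$, $$ |M_{i+1}| \leq n^{ -1/t}\cdot |M_i|. $$
   Context: Iterative sparsification process on $(G,t)$: Set $M_1=E$. For $i=1,\ldots,t$: sample $n^{1+1/t}\cdot\log n$ edges from $M_i$ uniformly at random without replacement (taking all of $M_i$ if it has no more edges than that) to obtain a subgraph $H_i$ of $(V,M_i)$; let $C_i$ be a proper coloring of $H_i$ with $\chi(H_i)$ colors (chosen arbitrarily, possibly depending on all random choices so far); let $M_{i+1}\subseteq M_i$ be the set of edges in $M_i$ that are monochromatic under $C_i$. Here $\chi$ denotes the chromatic number, $\log$ is base 2, and "exponentially high probability" means probability at least $1-2^{ -\Omega(n)}$ over the random samples. -}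

module Defs where

import Algebra.Definitions.RawSemiring
open import Data.Bool.Base using (if_then_else_)
open import Data.Fin.Base using (Fin; suc; inject₁; _<_)
open import Data.Fin.Properties using (_<?_; all?)
import Data.Fin.Properties as Fin
open import Data.Integer.Base using (+_)
open import Data.List.Base
  using (List; []; _∷_; _++_; map; concatMap; mapMaybe; filter; length; foldr;
         cartesianProduct; allFin)
open import Data.List.Relation.Unary.All using (All)
open import Data.Maybe.Base using (Maybe)
import Data.Maybe.Base as Maybe
open import Data.Nat.Base using (ℕ; zero; suc; _*_; _^_; _≤_; _⊓_; NonZero)
import Data.Nat.Properties as ℕ
open import Data.Product.Base using (_×_; _,_; Σ-syntax)
open import Data.Rational.Base using (ℚ; 0ℚ; 1ℚ; _/_)
import Data.Rational.Base as ℚ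
open import Data.Vec.Base using (Vec; []; _∷_; lookup)
open import Level using (0ℓ)
open import Relation.Binary.Core using (Rel)
import Relation.Binary.Definitions as B
open import Relation.Binary.PropositionalEquality.Core using (_≡_; _≢_)
open import Relation.Nullary.Decidable.Core using (does; dec⇒maybe)
open import Relation.Unary using (Pred; Decidable)

open Algebra.Definitions.RawSemiring ℚ.+-*-rawSemiring
  using () renaming (_^_ to _^ℚ_)

------------------------------------------------------------------------
-- Graphs

record Graph (n : ℕ) : Set₁ where
  field
    _~_      : Rel (Fin n) 0ℓ
    _~?_     : B.Decidable _~_
    ~-sym    : B.Symmetric _~_
    ~-irrefl : B.Irreflexive _≡_ _~_

-- An unordered pair of distinct vertices, stored with its smaller end first.

record Edge (n : ℕ) : Set where
  constructor edge
  field
    src tgt  : Fin n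
    .src<tgt : src < tgt

open Edge public

-- As lists; those arising in the process have no duplicates, being sublists
-- of `edges G`.

EdgeSet : ℕ → Set
EdgeSet n = List (Edge n)

toEdge : ∀ {n} → Fin n × Fin n → Maybe (Edge n)
toEdge (u , v) = Maybe.map (λ u<v → edge u v u<v) (dec⇒maybe (u <? v))

edges : ∀ {n} → Graph n → EdgeSet n
edges {n} G =
  filter (λ e → src e ~? tgt e)
         (mapMaybe toEdge (cartesianProduct (allFin n) (allFin n)))
  where open Graph G

Proper : ∀ {n k} → EdgeSet n → (Fin n → Fin k) → Set
Proper H c = All (λ e → c (src e) ≢ c (tgt e)) H

Colorable : ∀ {n} → EdgeSet n → ℕ → Set
Colorable {n} H k = Σ[ c ∈ (Fin n → Fin k) ] Proper H c

IsChromaticNumber : ∀ {n} → EdgeSet n → ℕ → Set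
IsChromaticNumber H k = Colorable H k × (∀ j → Colorable H j → k ≤ j)

record OptimalColoring {n : ℕ} (H : EdgeSet n) : Set where
  field
    χ      : ℕ
    χ-isχ  : IsChromaticNumber H χ
    color  : Fin n → Fin χ
    proper : Proper H color

monochromatic : ∀ {n k} → (Fin n → Fin k) → EdgeSet n → EdgeSet n
monochromatic c = filter (λ e → c (src e) Fin.≟ c (tgt e))

------------------------------------------------------------------------
-- Finitely supported distributions, as lists of weighted outcomes

Dist : Set → Set
Dist A = List (ℚ × A)

pure : ∀ {A} → A → Dist A
pure a = (1ℚ , a) ∷ []

_>>=_ : ∀ {A B} → Dist A → (A → Dist B) → Dist B
d >>= f = concatMap (λ { (p , a) → map (λ { (q , b) → p ℚ.* q , b }) (f a) }) d

-- A probability distribution only when the list is nonempty.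

uniform : ∀ {A} → List A → Dist A
uniform []         = []
uniform xs@(_ ∷ _) = map (λ x → + 1 / length xs , x) xs

Pr : ∀ {A} {P : Pred A 0ℓ} → Decidable P → Dist A → ℚ
Pr P? = foldr (λ { (p , a) r → (if does (P? a) then p else 0ℚ) ℚ.+ r }) 0ℚ

-- All k-element sublists, one for each k-element set of positions.

choose : ∀ {A : Set} → ℕ → List A → List (List A)
choose zero    _        = [] ∷ []
choose (suc k) []       = []
choose (suc k) (x ∷ xs) = map (x ∷_) (choose k xs) ++ choose (suc k) xs

-- s elements without replacement, or everything if there are at most s.
-- The first argument of `choose` is at most the length, so the list of
-- candidates is nonempty.

sample : ∀ {A : Set} → ℕ → List A → Dist (List A)
sample s M = uniform (choose (s ⊓ length M) M)

------------------------------------------------------------------------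
-- The sample size ⌈ n^(1+1/t) · log₂ n ⌉

-- p / q ≤ log₂ n

_/_≤log₂_ : ℕ → ℕ → ℕ → Set
p / q ≤log₂ n = 2 ^ p ≤ n ^ q

-- r / u ≤ n^(1+1/t)

_/_≤_^1+1/_ : ℕ → ℕ → ℕ → ℕ → Set
r / u ≤ n ^1+1/ t = r ^ t ≤ n ^ suc t * u ^ t

-- n^(1+1/t) · log₂ n ≤ s, both factors given by their lower cuts: the
-- product of two nonnegative reals is the supremum of the products of
-- nonnegative rationals below them.

EnoughSamples : ℕ → ℕ → ℕ → Set
EnoughSamples n t s =
  ∀ p q r u → NonZero q → NonZero u →
  p / q ≤log₂ n → r / u ≤ n ^1+1/ t → r * p ≤ s * (u * q)

IsSampleSize : ℕ → ℕ → ℕ → Set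
IsSampleSize n t s =
  EnoughSamples n t s × (∀ s′ → EnoughSamples n t s′ → s ≤ s′)

------------------------------------------------------------------------
-- The process

-- The adversary picks Cᵢ knowing Hᵢ₋₁ , … , H₁ (first argument, latest
-- first) and Hᵢ; these determine every earlier Cⱼ and Mⱼ.

Strategy : ℕ → Set
Strategy n = List (EdgeSet n) → (H : EdgeSet n) → OptimalColoring H

rounds : ∀ {n} → ℕ → Strategy n → (k : ℕ) → List (EdgeSet n) → EdgeSet n →
         Dist (Vec (EdgeSet n) (suc k))
rounds s σ zero    past M = pure (M ∷ [])
rounds s σ (suc k) past M =
  sample s M >>= λ H →
  rounds s σ k (H ∷ past) (monochromatic (color (σ past H)) M) >>= λ Ms →
  pure (M ∷ Ms)
  where open OptimalColoring

-- The joint distribution of M₁ , … , Mₜ₊₁.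

sparsification : ∀ {n} → Graph n → (t s : ℕ) → Strategy n →
                 Dist (Vec (EdgeSet n) (suc t))
sparsification G t s σ = rounds s σ t [] (edges G)

-- |Mᵢ₊₁| ≤ n^(-1/t) · |Mᵢ| for all i, with both sides raised to the power t
-- and the factor 1/n cleared.

AllShrink : ∀ n t → Vec (EdgeSet n) (suc t) → Set
AllShrink n t Ms = ∀ (i : Fin t) →
  n * length (lookup Ms (suc i)) ^ t ≤ length (lookup Ms (inject₁ i)) ^ t

allShrink? : ∀ n t → Decidable (AllShrink n t)
allShrink? n t Ms = all? λ i →
  n * length (lookup Ms (suc i)) ^ t ℕ.≤? length (lookup Ms (inject₁ i)) ^ t

------------------------------------------------------------------------
-- p ≥ 1 - 2^(-(a/b)·n), for a probability p and b ≥ 1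

_≥1-2^-[_/_]·_ : ℚ → ℕ → ℕ → ℕ → Set
p ≥1-2^-[ a / b ]· n = ((1ℚ ℚ.- p) ^ℚ b) ℚ.* (+ (2 ^ (a * n)) / 1) ℚ.≤ 1ℚ

{-# OPTIONS --safe #-}
-- Fix M with more than s edges and a map c from the vertices to n colors that is monochromatic
-- on a fraction x > n^(-1/t) of M. Of the s-element samples of M, a fraction of at most
-- (1 - x)^s ≤ 2^(-5xs/4) avoids every monochromatic edge, and xs ≥ n log₂ n, so for n ≥ 2^20 this
-- is at most (16n)^(-n). A union bound over the n^n maps shows that a round fails with probability
-- at most 16^(-n), whatever coloring is chosen. A round that does not fail removes an edge as long
-- as there is one, and a round whose sample is everything empties M, so only |E| ≤ n² rounds
-- matter before the first failure, whatever t is. To make this additive along the process, the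
-- failure probability of the rounds that start from M is bounded by |M| / 8^n, by induction on the
-- number of rounds.
module Submission where

open import Data.Bool.Base using (true; false; if_then_else_)
open import Data.Empty using (⊥-elim-irr)
open import Data.Fin.Base using (Fin; zero; suc; inject₁; inject≤)
import Data.Fin.Properties as Fin
import Data.Integer.Base as ℤ
import Data.Integer.Properties as ℤ
open import Data.List.Base
  using (List; []; _∷_; _++_; map; filter; length; allFin; cartesianProduct; cartesianProductWith;
         mapMaybe)
open import Data.List.Membership.Propositional using (_∈_; lose)
open import Data.List.Membership.Propositional.Properties using (∈-cartesianProductWith⁺; ∈-allFin)
open import Data.List.Properties
  using (length-++; length-map; length-tabulate; length-mapMaybe; length-filter; length-++-≤ˡ;
         filter-++; filter-none; filter-≐)
open import Data.List.Relation.Unary.All as All using (All; []; _∷_; all?)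
import Data.List.Relation.Unary.All.Properties as All
open import Data.List.Relation.Unary.Any using (Any; here; there; any?)
open import Data.Nat.Base
open import Data.Nat.Combinatorics
  using (_C_; _P_; nCk≡nPk/k!; nPk≡n!/[n∸k]!; k>n⇒nCk≡0; nCk+nC[k+1]≡[n+1]C[k+1])
open import Data.Nat.Combinatorics.Base using (_P′_)
open import Data.Nat.Combinatorics.Specification using (k!∣nP′k; nP′k≡n!/[n∸k]!)
open import Data.Nat.DivMod using (m/n*n≡m)
open import Data.Nat.ListAction using (sum)
open import Data.Nat.Properties
open import Data.Nat.Tactic.RingSolver using (solve-∀)
open import Data.Product.Base using (_×_; _,_; proj₁; proj₂; ∃-syntax)
open import Data.Rational.Base as ℚ using (ℚ; 0ℚ; 1ℚ; toℚᵘ)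
import Data.Rational.Properties as ℚ
open import Data.Rational.Solver using (module +-*-Solver)
open import Data.Rational.Unnormalised.Base as ℚᵘ using (mkℚᵘ; *≡*; *≤*)
import Data.Rational.Unnormalised.Properties as ℚᵘ
open import Data.Sum.Base using (_⊎_; inj₁; inj₂)
open import Data.Vec.Base using (Vec; []; _∷_; lookup; tabulate; head)
open import Data.Vec.Properties using (lookup∘tabulate)
open import Defs
open import Level using (0ℓ)
open import Relation.Binary.PropositionalEquality
open import Relation.Nullary using (Dec; does; ¬_; ¬?; yes; no; contradiction; _×-dec_)
open import Relation.Unary using (Pred; Decidable)

private variable
  A B : Set

-- Estimates in ℕ

^-cancelˡ-≤ : ∀ k .{{_ : NonZero k}} {a b} → a ^ k ≤ b ^ k → a ≤ b
^-cancelˡ-≤ k a^k≤b^k = ≮⇒≥ λ b<a → <⇒≱ (^-monoˡ-< k b<a) a^k≤b^k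

^-distribʳ-* : ∀ k x y → (x * y) ^ k ≡ x ^ k * y ^ k
^-distribʳ-* zero    x y = refl
^-distribʳ-* (suc k) x y = trans (cong (x * y *_) (^-distribʳ-* k x y)) (eq x y (x ^ k) (y ^ k))
  where
  eq : ∀ u v w z → u * v * (w * z) ≡ u * w * (v * z)
  eq = solve-∀

floor-log₂ : ∀ n .{{_ : NonZero n}} → ∃[ p ] 2 ^ p ≤ n × n < 2 ^ suc p
floor-log₂ 1 = 0 , ≤-refl , ≤-refl
floor-log₂ (suc n@(suc _)) with floor-log₂ n
... | p , 2^p≤n , n<2^1+p with suc n <? 2 ^ suc p
...   | yes 1+n<2^1+p = p , m≤n⇒m≤1+n 2^p≤n , 1+n<2^1+p
...   | no  1+n≮2^1+p = suc p , ≮⇒≥ 1+n≮2^1+p , (begin-strict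
  suc n           ≤⟨ n<2^1+p ⟩
  2 ^ suc p       <⟨ ^-monoʳ-< 2 ≤-refl (n<1+n (suc p)) ⟩
  2 ^ suc (suc p) ∎)
  where open ≤-Reasoning

-- The first three terms of the binomial expansion of (1 + 1/n)^(j+1), times 2n² · n^(j+1).
[1+n]^k-binomial₂ : ∀ n j →
  n ^ suc j * (2 * (n * n) + 2 * (suc j * n) + suc j * j) ≤ 2 * (n * n) * suc n ^ suc j
[1+n]^k-binomial₂ n zero = ≤-reflexive (eq n)
  where
  eq : ∀ n → n * 1 * (2 * (n * n) + 2 * (1 * n) + 1 * 0) ≡ 2 * (n * n) * (suc n * 1)
  eq = solve-∀
[1+n]^k-binomial₂ n (suc j) = begin
  n * x * (2 * (n * n) + 2 * (suc (suc j) * n) + suc (suc j) * suc j)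
    ≤⟨ m≤m+n _ (x * (suc j * j)) ⟩
  n * x * (2 * (n * n) + 2 * (suc (suc j) * n) + suc (suc j) * suc j) + x * (suc j * j)
    ≡⟨ eq₁ n x j ⟩
  suc n * (x * (2 * (n * n) + 2 * (suc j * n) + suc j * j))
    ≤⟨ *-monoʳ-≤ (suc n) ([1+n]^k-binomial₂ n j) ⟩
  suc n * (2 * (n * n) * suc n ^ suc j)
    ≡⟨ eq₂ n (suc n ^ suc j) ⟩
  2 * (n * n) * (suc n * suc n ^ suc j) ∎
  where
  open ≤-Reasoning
  x = n ^ suc j
  eq₁ : ∀ n x j →
    n * x * (2 * (n * n) + 2 * (suc (suc j) * n) + suc (suc j) * suc j) + x * (suc j * j)
    ≡ suc n * (x * (2 * (n * n) + 2 * (suc j * n) + suc j * j))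
  eq₁ = solve-∀
  eq₂ : ∀ n y → suc n * (2 * (n * n) * y) ≡ 2 * (n * n) * (suc n * y)
  eq₂ = solve-∀

-- The first three binomial terms of (1 + 1/n)^(n+1) already add up to 5/2 + 3/(2n); the summand
-- `x * (3 * n)` is the part above 5/2.
5n^[1+n]≤2[1+n]^[1+n] : ∀ n → 5 * n ^ suc n ≤ 2 * suc n ^ suc n
5n^[1+n]≤2[1+n]^[1+n] zero      = z≤n
5n^[1+n]≤2[1+n]^[1+n] n@(suc _) = *-cancelˡ-≤ (n * n) (begin
  n * n * (5 * x)                                       ≤⟨ m≤m+n _ (x * (3 * n)) ⟩
  n * n * (5 * x) + x * (3 * n)                         ≡⟨ eq₁ n x ⟩
  x * (2 * (n * n) + 2 * (suc n * n) + suc n * n)       ≤⟨ [1+n]^k-binomial₂ n n ⟩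
  2 * (n * n) * suc n ^ suc n                           ≡⟨ eq₂ n (suc n ^ suc n) ⟩
  n * n * (2 * suc n ^ suc n)                           ∎)
  where
  open ≤-Reasoning
  x = n ^ suc n
  eq₁ : ∀ n x → n * n * (5 * x) + x * (3 * n) ≡ x * (2 * (n * n) + 2 * (suc n * n) + suc n * n)
  eq₁ = solve-∀
  eq₂ : ∀ n y → 2 * (n * n) * y ≡ n * n * (2 * y)
  eq₂ = solve-∀

-- (5/2)⁴ = 625/16 exceeds 32 = 512/16. This is the source of the exponent 5/4: 2^(5/4) ≤ 5/2.
32n^4[1+n]≤[1+n]^4[1+n] : ∀ n → 32 * (n ^ suc n) ^ 4 ≤ (suc n ^ suc n) ^ 4
32n^4[1+n]≤[1+n]^4[1+n] n = *-cancelˡ-≤ 16 (begin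
  16 * (32 * x ^ 4)  ≡⟨ *-assoc 16 32 (x ^ 4) ⟨
  512 * x ^ 4        ≤⟨ *-monoˡ-≤ (x ^ 4) (m≤m+n 512 113) ⟩
  625 * x ^ 4        ≡⟨ eq₁ x ⟩
  (5 * x) ^ 4        ≤⟨ ^-monoˡ-≤ 4 (5n^[1+n]≤2[1+n]^[1+n] n) ⟩
  (2 * y) ^ 4        ≡⟨ eq₂ y ⟩
  16 * y ^ 4         ∎)
  where
  open ≤-Reasoning
  x = n ^ suc n
  y = suc n ^ suc n
  eq₁ : ∀ x → 625 * (x * (x * (x * (x * 1)))) ≡ (5 * x) * ((5 * x) * ((5 * x) * ((5 * x) * 1)))
  eq₁ = solve-∀
  eq₂ : ∀ x → (2 * x) * ((2 * x) * ((2 * x) * ((2 * x) * 1))) ≡ 16 * (x * (x * (x * (x * 1))))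
  eq₂ = solve-∀

-- (1 - x)⁴ ≤ 2^(-5x) for x = m / (m + d), raised to the power m + d. The bound
-- 1 - x ≤ 2^(-x) would only just match the n^n colorings of the union bound.
[1-x]^4≤2^-5x : ∀ d m → (d ^ (m + d)) ^ 4 * 32 ^ m ≤ ((m + d) ^ (m + d)) ^ 4
[1-x]^4≤2^-5x d zero    = ≤-reflexive (*-identityʳ _)
-- With n = m + d, the extra factor d⁴ is at most n⁴, and the extra factor 32 pays for replacing the
-- base n by n + 1 under the exponent n + 1.
[1-x]^4≤2^-5x d (suc m) = begin
  (d * d ^ n) ^ 4 * (32 * 32 ^ m)       ≡⟨ eq d (d ^ n) (32 ^ m) ⟩
  32 * (d ^ 4 * ((d ^ n) ^ 4 * 32 ^ m)) ≤⟨ *-monoʳ-≤ 32 (*-mono-≤ (^-monoˡ-≤ 4 (m≤n+m d m))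
                                                              ([1-x]^4≤2^-5x d m)) ⟩
  32 * (n ^ 4 * (n ^ n) ^ 4)            ≡⟨ cong (32 *_) (eq′ n (n ^ n)) ⟩
  32 * (n ^ suc n) ^ 4                  ≤⟨ 32n^4[1+n]≤[1+n]^4[1+n] n ⟩
  (suc n ^ suc n) ^ 4                   ∎
  where
  open ≤-Reasoning
  n = m + d
  eq : ∀ d x z → (d * x) * ((d * x) * ((d * x) * ((d * x) * 1))) * (32 * z)
                 ≡ 32 * (d * (d * (d * (d * 1))) * (x * (x * (x * (x * 1))) * z))
  eq = solve-∀
  eq′ : ∀ d x → d * (d * (d * (d * 1))) * (x * (x * (x * (x * 1))))
                ≡ (d * x) * ((d * x) * ((d * x) * ((d * x) * 1)))
  eq′ = solve-∀

-- The falling factorials are compared factor by factor: (a - i) / (n - i) ≤ a / n since a ≤ n.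
P′-ratio : ∀ {a n} k → a ≤ n → (a P′ k) * n ^ k ≤ (n P′ k) * a ^ k
P′-ratio zero a≤n = ≤-refl
P′-ratio {a} {n} (suc k) a≤n = begin
  (a ∸ k) * (a P′ k) * (n * n ^ k)   ≡⟨ eq (a ∸ k) (a P′ k) n (n ^ k) ⟩
  (a ∸ k) * n * ((a P′ k) * n ^ k)   ≤⟨ *-mono-≤ step (P′-ratio k a≤n) ⟩
  (n ∸ k) * a * ((n P′ k) * a ^ k)   ≡⟨ eq (n ∸ k) (n P′ k) a (a ^ k) ⟨
  (n ∸ k) * (n P′ k) * (a * a ^ k)   ∎
  where
  open ≤-Reasoning
  eq : ∀ u v w x → u * v * (w * x) ≡ u * w * (v * x)
  eq = solve-∀
  step : (a ∸ k) * n ≤ (n ∸ k) * a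
  step = begin
    (a ∸ k) * n    ≡⟨ *-distribʳ-∸ n a k ⟩
    a * n ∸ k * n  ≤⟨ ∸-mono (≤-reflexive (*-comm a n)) (*-monoʳ-≤ k a≤n) ⟩
    n * a ∸ k * a  ≡⟨ *-distribʳ-∸ a n k ⟨
    (n ∸ k) * a    ∎

nCk*k!≡nP′k : ∀ {n k} → k ≤ n → (n C k) * k ! ≡ n P′ k
nCk*k!≡nP′k {n} {k} k≤n = begin
  (n C k) * k !          ≡⟨ cong (_* k !) (nCk≡nPk/k! k≤n) ⟩
  ((n P k) / k !) * k !  ≡⟨ cong (λ x → (x / k !) * k !) nPk≡nP′k ⟩
  ((n P′ k) / k !) * k ! ≡⟨ m/n*n≡m (k!∣nP′k k≤n) ⟩
  n P′ k                 ∎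
  where
  open ≡-Reasoning
  instance _ = k !≢0
  nPk≡nP′k : n P k ≡ n P′ k
  nPk≡nP′k = trans (nPk≡n!/[n∸k]! k≤n) (sym (nP′k≡n!/[n∸k]! k≤n))

-- Sampling k of n items without replacement hits only a given set of a items with probability at
-- most (a / n)^k, the value with replacement. Multiplying by k! reduces this to falling factorials.
C-ratio : ∀ {a n} k → a ≤ n → (a C k) * n ^ k ≤ (n C k) * a ^ k
C-ratio {a} {n} k a≤n with k ≤? a
... | no  k≰a rewrite k>n⇒nCk≡0 (≰⇒> k≰a) = z≤n
... | yes k≤a = *-cancelʳ-≤ _ _ (k !) (begin
  (a C k) * n ^ k * k !    ≡⟨ eq (a C k) (n ^ k) (k !) ⟩
  (a C k) * k ! * n ^ k    ≡⟨ cong (_* n ^ k) (nCk*k!≡nP′k k≤a) ⟩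
  (a P′ k) * n ^ k         ≤⟨ P′-ratio k a≤n ⟩
  (n P′ k) * a ^ k         ≡⟨ cong (_* a ^ k) (nCk*k!≡nP′k (≤-trans k≤a a≤n)) ⟨
  (n C k) * k ! * a ^ k    ≡⟨ eq (n C k) (a ^ k) (k !) ⟨
  (n C k) * a ^ k * k !    ∎)
  where
  open ≤-Reasoning
  instance _ = k !≢0
  eq : ∀ u v w → u * v * w ≡ u * w * v
  eq = solve-∀

-- Samples that avoid the monochromatic edges of one map

module _ {n t s c : ℕ} (20≤c : 20 ≤ c) (2^c≤n : 2 ^ c ≤ n) (enough : EnoughSamples n t s) where
  open ≤-Reasoning

  private instance
    n≢0 : NonZero n
    n≢0 = >-nonZero (≤-trans (m^n>0 2 c) 2^c≤n)

  -- From 16n < 2^(p+5) the fourth power is below 2^(4p+20), and 4p + 20 ≤ 5p because p ≥ 20. The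
  -- threshold 2^20 comes from here: the surplus of 5/4 over 1 absorbs both the factor 16 and the
  -- rounding of log₂ n down to p.
  [16n]^4≤2^5p : ∀ p → n < 2 ^ suc p → (16 * n) ^ 4 ≤ 2 ^ (5 * p)
  [16n]^4≤2^5p p n<2^1+p = fourth-power (4 + suc p) (5 * p) 16n≤2^5+p exponents
    where
    fourth-power : ∀ {a} e f → a ≤ 2 ^ e → e * 4 ≤ f → a ^ 4 ≤ 2 ^ f
    fourth-power {a} e f a≤2^e e*4≤f = begin
      a ^ 4        ≤⟨ ^-monoˡ-≤ 4 a≤2^e ⟩
      (2 ^ e) ^ 4  ≡⟨ ^-*-assoc 2 e 4 ⟩
      2 ^ (e * 4)  ≤⟨ ^-monoʳ-≤ 2 e*4≤f ⟩
      2 ^ f        ∎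
    16n≤2^5+p : 16 * n ≤ 2 ^ (4 + suc p)
    16n≤2^5+p = ≤-trans (*-monoʳ-≤ 16 (<⇒≤ n<2^1+p)) (≤-reflexive (sym (^-distribˡ-+-* 2 4 (suc p))))
    20≤p : 20 ≤ p
    20≤p = ≤-trans 20≤c (≮⇒≥ λ p<c → <⇒≱ n<2^1+p (≤-trans (^-monoʳ-≤ 2 p<c) 2^c≤n))
    eq : ∀ p → (4 + suc p) * 4 ≡ 20 + 4 * p
    eq = solve-∀
    exponents : (4 + suc p) * 4 ≤ 5 * p
    exponents = ≤-trans (≤-reflexive (eq p)) (+-monoˡ-≤ (4 * p) 20≤p)

  -- With N = m + d and x = m / N this is (1 - x)^s ≤ (16n)^(-n). Both sides are raised to the power
  -- 4N, where the s-th power of `[1-x]^4≤2^-5x` leaves 32^(ms) ≥ (16n)^(4nN) to show.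
  avoid-power : ∀ d m {{m≢0 : NonZero m}} → (m + d) ^ t < n * m ^ t →
                d ^ s * (16 * n) ^ n ≤ (m + d) ^ s
  avoid-power d m {{m≢0}} large with floor-log₂ n
  ... | p , 2^p≤n , n<2^1+p = ^-cancelˡ-≤ 4 (^-cancelˡ-≤ N (begin
    ((d ^ s * (16 * n) ^ n) ^ 4) ^ N
      ≡⟨ cong (_^ N) (^-distribʳ-* 4 (d ^ s) ((16 * n) ^ n)) ⟩
    ((d ^ s) ^ 4 * ((16 * n) ^ n) ^ 4) ^ N
      ≡⟨ ^-distribʳ-* N ((d ^ s) ^ 4) _ ⟩
    ((d ^ s) ^ 4) ^ N * (((16 * n) ^ n) ^ 4) ^ N
      ≤⟨ *-monoʳ-≤ (((d ^ s) ^ 4) ^ N) [16n]^4nN≤32^ms ⟩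
    ((d ^ s) ^ 4) ^ N * (32 ^ m) ^ s
      ≡⟨ cong (_* (32 ^ m) ^ s) (^-swap d) ⟩
    ((d ^ N) ^ 4) ^ s * (32 ^ m) ^ s
      ≡⟨ ^-distribʳ-* s ((d ^ N) ^ 4) (32 ^ m) ⟨
    ((d ^ N) ^ 4 * 32 ^ m) ^ s
      ≤⟨ ^-monoˡ-≤ s ([1-x]^4≤2^-5x d m) ⟩
    ((N ^ N) ^ 4) ^ s
      ≡⟨ ^-swap N ⟨
    ((N ^ s) ^ 4) ^ N ∎))
    where
    N = m + d
    instance
      N≢0 : NonZero N
      N≢0 = >-nonZero (≤-trans (>-nonZero⁻¹ m) (m≤m+n m d))
    ^-comm : ∀ x i j → (x ^ i) ^ j ≡ (x ^ j) ^ i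
    ^-comm x i j = trans (^-*-assoc x i j) (trans (cong (x ^_) (*-comm i j)) (sym (^-*-assoc x j i)))
    ^-swap : ∀ x → ((x ^ s) ^ 4) ^ N ≡ ((x ^ N) ^ 4) ^ s
    ^-swap x = trans (^-comm (x ^ s) 4 N) (trans (cong (_^ 4) (^-comm x s N)) (^-comm (x ^ N) s 4))
    -- The sample size is tested against two rationals, p / 1 ≤ log₂ n and nN / m ≤ n^(1+1/t). The
    -- second holds since N / m < n^(1/t) by `large`.
    nNp≤sm : n * N * p ≤ s * (m * 1)
    nNp≤sm = enough p 1 (n * N) m _ m≢0 2^p≤n^1 (begin
      (n * N) ^ t         ≡⟨ ^-distribʳ-* t n N ⟩
      n ^ t * N ^ t       ≤⟨ *-monoʳ-≤ (n ^ t) (<⇒≤ large) ⟩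
      n ^ t * (n * m ^ t) ≡⟨ eq (n ^ t) n (m ^ t) ⟩
      n * n ^ t * m ^ t   ∎)
      where
      2^p≤n^1 : 2 ^ p ≤ n ^ 1
      2^p≤n^1 = ≤-trans 2^p≤n (≤-reflexive (sym (*-identityʳ n)))
      eq : ∀ a b c → a * (b * c) ≡ b * a * c
      eq = solve-∀
    [16n]^4nN≤32^ms : (((16 * n) ^ n) ^ 4) ^ N ≤ (32 ^ m) ^ s
    [16n]^4nN≤32^ms = begin
      (((16 * n) ^ n) ^ 4) ^ N   ≡⟨ cong (_^ N) (^-comm (16 * n) n 4) ⟩
      (((16 * n) ^ 4) ^ n) ^ N   ≤⟨ ^-monoˡ-≤ N (^-monoˡ-≤ n ([16n]^4≤2^5p p n<2^1+p)) ⟩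
      ((2 ^ (5 * p)) ^ n) ^ N    ≡⟨ cong (_^ N) (^-*-assoc 2 (5 * p) n) ⟩
      (2 ^ (5 * p * n)) ^ N      ≡⟨ ^-*-assoc 2 (5 * p * n) N ⟩
      2 ^ (5 * p * n * N)        ≡⟨ cong (2 ^_) (eq₁ p n N) ⟩
      2 ^ (5 * (n * N * p))      ≤⟨ ^-monoʳ-≤ 2 (*-monoʳ-≤ 5 nNp≤sm) ⟩
      2 ^ (5 * (s * (m * 1)))    ≡⟨ cong (2 ^_) (eq₂ s m) ⟩
      2 ^ (5 * (m * s))          ≡⟨ ^-*-assoc 2 5 (m * s) ⟨
      32 ^ (m * s)               ≡⟨ ^-*-assoc 32 m s ⟨
      (32 ^ m) ^ s               ∎
      where
      eq₁ : ∀ p n k → 5 * p * n * k ≡ 5 * (n * k * p)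
      eq₁ = solve-∀
      eq₂ : ∀ s m → 5 * (s * (m * 1)) ≡ 5 * (m * s)
      eq₂ = solve-∀

  avoid-count : ∀ d m {{m≢0 : NonZero m}} → (m + d) ^ t < n * m ^ t →
                (d C s) * (16 * n) ^ n ≤ (m + d) C s
  avoid-count d m large = *-cancelʳ-≤ _ _ (N ^ s) (begin
    (d C s) * (16 * n) ^ n * N ^ s    ≡⟨ eq (d C s) ((16 * n) ^ n) (N ^ s) ⟩
    (d C s) * N ^ s * (16 * n) ^ n    ≤⟨ *-monoˡ-≤ ((16 * n) ^ n) (C-ratio s (m≤n+m d m)) ⟩
    (N C s) * d ^ s * (16 * n) ^ n    ≡⟨ *-assoc (N C s) (d ^ s) _ ⟩
    (N C s) * (d ^ s * (16 * n) ^ n)  ≤⟨ *-monoʳ-≤ (N C s) (avoid-power d m large) ⟩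
    (N C s) * N ^ s                   ∎)
    where
    N = m + d
    instance
      N^s≢0 : NonZero (N ^ s)
      N^s≢0 = m^n≢0 N s {{>-nonZero (≤-trans (>-nonZero⁻¹ m) (m≤m+n m d))}}
    eq : ∀ u v w → u * v * w ≡ u * w * v
    eq = solve-∀

-- Counting samples and colorings

count : {P : Pred A 0ℓ} → Decidable P → List A → ℕ
count P? xs = length (filter P? xs)

count-⊎ : {P Q R : Pred A 0ℓ} (P? : Decidable P) (Q? : Decidable Q) (R? : Decidable R) →
          (∀ {x} → P x → Q x ⊎ R x) → ∀ xs → count P? xs ≤ count Q? xs + count R? xs
count-⊎ P? Q? R? P⇒Q⊎R [] = z≤n
count-⊎ P? Q? R? P⇒Q⊎R (x ∷ xs) with ih ← count-⊎ P? Q? R? P⇒Q⊎R xs | P? x | Q? x | R? x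
... | no  _ | no  _  | no  _  = ih
... | no  _ | no  _  | yes _  = ≤-trans ih (+-monoʳ-≤ (count Q? xs) (n≤1+n _))
... | no  _ | yes _  | no  _  = m≤n⇒m≤1+n ih
... | no  _ | yes _  | yes _  = m≤n⇒m≤1+n (≤-trans ih (+-monoʳ-≤ (count Q? xs) (n≤1+n _)))
... | yes _ | yes _  | no  _  = s≤s ih
... | yes _ | yes _  | yes _  = s≤s (≤-trans ih (+-monoʳ-≤ (count Q? xs) (n≤1+n _)))
... | yes _ | no  _  | yes _  = ≤-trans (s≤s ih) (≤-reflexive (sym (+-suc (count Q? xs) _)))
... | yes p | no ¬q  | no ¬r  with P⇒Q⊎R p
...   | inj₁ q = contradiction q ¬q
...   | inj₂ r = contradiction r ¬r

count-⊆ : {P Q : Pred A 0ℓ} (P? : Decidable P) (Q? : Decidable Q) →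
          (∀ {x} → P x → Q x) → ∀ xs → count P? xs ≤ count Q? xs
count-⊆ P? Q? P⇒Q [] = z≤n
count-⊆ P? Q? P⇒Q (x ∷ xs) with ih ← count-⊆ P? Q? P⇒Q xs | P? x | Q? x
... | no  _ | no  _ = ih
... | no  _ | yes _ = m≤n⇒m≤1+n ih
... | yes _ | yes _ = s≤s ih
... | yes p | no ¬q = contradiction (P⇒Q p) ¬q

count-∁ : {P : Pred A 0ℓ} (P? : Decidable P) → ∀ xs → count P? xs + count (λ x → ¬? (P? x)) xs ≡ length xs
count-∁ P? [] = refl
count-∁ P? (x ∷ xs) with ih ← count-∁ P? xs | P? x
... | yes _ = cong suc ih
... | no  _ = trans (+-suc (count P? xs) _) (cong suc ih)

count-map : ∀ {B : Set} {P : Pred B 0ℓ} (P? : Decidable P) (f : A → B) xs →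
            count P? (map f xs) ≡ count (λ x → P? (f x)) xs
count-map P? f [] = refl
count-map P? f (x ∷ xs) with ih ← count-map P? f xs | P? (f x)
... | yes _ = cong suc ih
... | no  _ = ih

count-++ : {P : Pred A 0ℓ} (P? : Decidable P) → ∀ xs ys → count P? (xs ++ ys) ≡ count P? xs + count P? ys
count-++ P? xs ys = trans (cong length (filter-++ P? xs ys)) (length-++ (filter P? xs))

union-bound : {B : Set} {Q : B → Pred A 0ℓ} (Q? : ∀ c → Decidable (Q c)) →
              ∀ {k l} xs → (∀ c → count (Q? c) xs * k ≤ l) →
              ∀ cs → count (λ x → any? (λ c → Q? c x) cs) xs * k ≤ length cs * l
union-bound Q? {k} xs bound [] = ≤-reflexive (cong (λ ys → length ys * k) (filter-none _ (All.universal (λ _ ()) xs)))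
union-bound Q? {k} {l} xs bound (c ∷ cs) = begin
  count (λ x → any? (λ c → Q? c x) (c ∷ cs)) xs * k
    ≤⟨ *-monoˡ-≤ k (count-⊎ _ (Q? c) any-cs? (λ { (here q) → inj₁ q ; (there qs) → inj₂ qs }) xs) ⟩
  (count (Q? c) xs + count any-cs? xs) * k
    ≡⟨ *-distribʳ-+ k (count (Q? c) xs) _ ⟩
  count (Q? c) xs * k + count any-cs? xs * k
    ≤⟨ +-mono-≤ (bound c) (union-bound Q? xs bound cs) ⟩
  l + length cs * l ∎
  where
  open ≤-Reasoning
  any-cs? = λ x → any? (λ c → Q? c x) cs

length-choose : ∀ k (xs : List A) → length (choose k xs) ≡ length xs C k
length-choose zero    xs       = refl
length-choose (suc k) []       = refl
length-choose (suc k) (x ∷ xs) = begin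
  length (map (x ∷_) (choose k xs) ++ choose (suc k) xs)        ≡⟨ length-++ (map (x ∷_) (choose k xs)) ⟩
  length (map (x ∷_) (choose k xs)) + length (choose (suc k) xs) ≡⟨ cong (_+ _) (length-map (x ∷_) (choose k xs)) ⟩
  length (choose k xs) + length (choose (suc k) xs)             ≡⟨ cong₂ _+_ (length-choose k xs) (length-choose (suc k) xs) ⟩
  length xs C k + length xs C suc k                             ≡⟨ nCk+nC[k+1]≡[n+1]C[k+1] (length xs) k ⟩
  suc (length xs) C suc k                                       ∎
  where open ≡-Reasoning

choose-> : ∀ {k} (xs : List A) → length xs < k → choose k xs ≡ []
choose-> {k = suc k} []       _           = refl
choose-> {k = suc k} (x ∷ xs) (s≤s |xs|<k)
  rewrite choose-> xs |xs|<k | choose-> xs (m≤n⇒m≤1+n |xs|<k) = refl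

choose-length : (xs : List A) → choose (length xs) xs ≡ xs ∷ []
choose-length []       = refl
choose-length (x ∷ xs) rewrite choose-length xs | choose-> xs ≤-refl = refl

-- The sublists of xs that satisfy P throughout are those of the filtered list. This makes the
-- number of samples without monochromatic edges a binomial coefficient.
count-all-choose : {P : Pred A 0ℓ} (P? : Decidable P) → ∀ k xs →
                   count (all? P?) (choose k xs) ≡ length (choose k (filter P? xs))
count-all-choose P? zero    xs = refl
count-all-choose P? (suc k) [] = refl
count-all-choose {P = P} P? (suc k) (x ∷ xs) with P? x
... | yes px = begin
  count (all? P?) (map (x ∷_) (choose k xs) ++ choose (suc k) xs)
    ≡⟨ count-++ (all? P?) (map (x ∷_) (choose k xs)) _ ⟩
  count (all? P?) (map (x ∷_) (choose k xs)) + count (all? P?) (choose (suc k) xs)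
    ≡⟨ cong₂ _+_ (count-map (all? P?) (x ∷_) (choose k xs)) (count-all-choose P? (suc k) xs) ⟩
  count (λ ys → all? P? (x ∷ ys)) (choose k xs) + length (choose (suc k) xs′)
    ≡⟨ cong (λ zs → length zs + _) (filter-≐ _ (all? P?) ((λ { (_ ∷ pys) → pys }) , (px ∷_)) (choose k xs)) ⟩
  count (all? P?) (choose k xs) + length (choose (suc k) xs′)
    ≡⟨ cong (_+ length (choose (suc k) xs′)) (count-all-choose P? k xs) ⟩
  length (choose k xs′) + length (choose (suc k) xs′)
    ≡⟨ cong (_+ _) (length-map (x ∷_) (choose k xs′)) ⟨
  length (map (x ∷_) (choose k xs′)) + length (choose (suc k) xs′)
    ≡⟨ length-++ (map (x ∷_) (choose k xs′)) ⟨
  length (map (x ∷_) (choose k xs′) ++ choose (suc k) xs′) ∎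
  where
  open ≡-Reasoning
  xs′ = filter P? xs
... | no ¬px = begin
  count (all? P?) (map (x ∷_) (choose k xs) ++ choose (suc k) xs)
    ≡⟨ count-++ (all? P?) (map (x ∷_) (choose k xs)) _ ⟩
  count (all? P?) (map (x ∷_) (choose k xs)) + count (all? P?) (choose (suc k) xs)
    ≡⟨ cong (_+ _) (count-map (all? P?) (x ∷_) (choose k xs)) ⟩
  count (λ ys → all? P? (x ∷ ys)) (choose k xs) + count (all? P?) (choose (suc k) xs)
    ≡⟨ cong (λ zs → length zs + _) (filter-none (λ ys → all? P? (x ∷ ys)) (All.universal (λ { _ (px ∷ _) → ¬px px }) (choose k xs))) ⟩
  count (all? P?) (choose (suc k) xs)
    ≡⟨ count-all-choose P? (suc k) xs ⟩
  length (choose (suc k) (filter P? xs)) ∎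
  where open ≡-Reasoning

length-cartesianProductWith : ∀ {B C : Set} (f : A → B → C) xs ys →
                              length (cartesianProductWith f xs ys) ≡ length xs * length ys
length-cartesianProductWith f []       ys = refl
length-cartesianProductWith f (x ∷ xs) ys = trans (length-++ (map (f x) ys))
  (cong₂ _+_ (length-map (f x) ys) (length-cartesianProductWith f xs ys))

length-edges : ∀ {n} (G : Graph n) → length (edges G) ≤ n * n
length-edges {n} G = begin
  length (edges G)                                            ≤⟨ length-filter _ (mapMaybe toEdge pairs) ⟩
  length (mapMaybe toEdge pairs)                              ≤⟨ length-mapMaybe toEdge pairs ⟩
  length pairs                                                ≡⟨ length-cartesianProductWith _,_ (allFin n) (allFin n) ⟩
  length (allFin n) * length (allFin n)                       ≡⟨ cong₂ _*_ (length-tabulate {n = n} _) (length-tabulate {n = n} _) ⟩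
  n * n                                                       ∎
  where
  open ≤-Reasoning
  pairs = cartesianProduct (allFin n) (allFin n)

colorings : ∀ k n → List (Vec (Fin k) n)
colorings k zero    = [] ∷ []
colorings k (suc n) = cartesianProductWith _∷_ (allFin k) (colorings k n)

length-colorings : ∀ k n → length (colorings k n) ≡ k ^ n
length-colorings k zero    = refl
length-colorings k (suc n) = trans (length-cartesianProductWith _∷_ (allFin k) (colorings k n))
  (cong₂ _*_ (length-tabulate {n = k} _) (length-colorings k n))

∈-colorings : ∀ {k n} (c : Vec (Fin k) n) → c ∈ colorings k n
∈-colorings []      = here refl
∈-colorings (x ∷ c) = ∈-cartesianProductWith⁺ _∷_ (∈-allFin x) (∈-colorings c)

-- Giving each vertex its own color is proper, as the ends of an edge differ. Hence an optimal
-- coloring is, up to renaming, a map into n colors.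
χ≤n : ∀ {n} {H : EdgeSet n} (κ : OptimalColoring H) → OptimalColoring.χ κ ≤ n
χ≤n {n} {H} κ = proj₂ χ-isχ n ((λ v → v) , All.universal (λ e → src≢tgt e) H)
  where
  open OptimalColoring κ
  src≢tgt : ∀ e → src e ≢ tgt e
  src≢tgt (edge u v u<v) u≡v = ⊥-elim-irr (Fin.<⇒≢ u<v u≡v)

-- Union bound over the n^n maps into n colors

module _ {n t : ℕ} where
  -- Here c is fixed before H is drawn; in Stalls the coloring depends on H.
  Fooled : EdgeSet n → Vec (Fin n) n → Pred (EdgeSet n) 0ℓ
  Fooled M c H = Proper H (lookup c) × length M ^ t < n * length (monochromatic (lookup c) M) ^ t

  fooled? : ∀ M c → Decidable (Fooled M c)
  fooled? M c H = all? (λ e → ¬? (lookup c (src e) Fin.≟ lookup c (tgt e))) H ×-dec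
                  length M ^ t <? n * length (monochromatic (lookup c) M) ^ t

  Stalls : EdgeSet n → ((H : EdgeSet n) → OptimalColoring H) → Pred (EdgeSet n) 0ℓ
  Stalls M κ H = length M ^ t < n * length (monochromatic (OptimalColoring.color (κ H)) M) ^ t

  stalls? : ∀ M κ → Decidable (Stalls M κ)
  stalls? M κ H = _ <? _

  -- The coloring chosen after seeing H embeds injectively into n colors, so it stays proper on H
  -- and keeps its monochromatic edges. The embedded map belongs to a list fixed before H is drawn,
  -- which is how the adversary's adaptivity is handled.
  stalls⇒fooled : ∀ M κ {H} → Stalls M κ H → Any (λ c → Fooled M c H) (colorings n n)
  stalls⇒fooled M κ {H} stalls = lose (∈-colorings c)
    (All.map (λ ≢ eq → ≢ (c-reflects eq)) proper , subst (λ m → length M ^ t < n * m ^ t) (cong length same) stalls)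
    where
    open OptimalColoring (κ H)
    c : Vec (Fin n) n
    c = tabulate (λ v → inject≤ (color v) (χ≤n (κ H)))
    c-reflects : ∀ {u v} → lookup c u ≡ lookup c v → color u ≡ color v
    c-reflects {u} {v} eq = Fin.inject≤-injective _ _ _ _
      (trans (sym (lookup∘tabulate _ u)) (trans eq (lookup∘tabulate _ v)))
    c-respects : ∀ {u v} → color u ≡ color v → lookup c u ≡ lookup c v
    c-respects {u} {v} eq = trans (lookup∘tabulate _ u)
      (trans (cong (λ x → inject≤ x (χ≤n (κ H))) eq) (sym (lookup∘tabulate _ v)))
    same : monochromatic color M ≡ monochromatic (lookup c) M
    same = filter-≐ _ _ (c-respects , c-reflects) M

  module _ {s c} (20≤c : 20 ≤ c) (2^c≤n : 2 ^ c ≤ n) (enough : EnoughSamples n t s)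
           .{{_ : NonZero t}} where
    open ≤-Reasoning

    -- The second condition in `Fooled` does not mention H: either it fails and no sample counts, or
    -- it is the hypothesis of `avoid-count`. A sample properly colored by c consists of bichromatic
    -- edges, so at most C(d, s) samples are to be counted.
    count-fooled : ∀ M c → count (fooled? M c) (choose s M) * (16 * n) ^ n ≤ length (choose s M)
    count-fooled M c with <-≤-connex (length M ^ t) (n * length (monochromatic (lookup c) M) ^ t)
    ... | inj₂ ¬large = ≤-trans (≤-reflexive (cong (λ zs → length zs * (16 * n) ^ n)
            (filter-none (fooled? M c) (All.universal (λ _ fooled → ≤⇒≯ ¬large (proj₂ fooled)) (choose s M))))) z≤n
    ... | inj₁ large = begin
      count (fooled? M c) (choose s M) * (16 * n) ^ n
        ≤⟨ *-monoˡ-≤ ((16 * n) ^ n) (count-⊆ (fooled? M c) (all? bichromatic?) proj₁ (choose s M)) ⟩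
      count (all? bichromatic?) (choose s M) * (16 * n) ^ n
        ≡⟨ cong (_* (16 * n) ^ n) (count-all-choose bichromatic? s M) ⟩
      length (choose s (filter bichromatic? M)) * (16 * n) ^ n
        ≡⟨ cong (_* (16 * n) ^ n) (length-choose s (filter bichromatic? M)) ⟩
      (d C s) * (16 * n) ^ n
        ≤⟨ avoid-count {n} {t} {s} 20≤c 2^c≤n enough d m {{m≢0}} (subst (λ k → k ^ t < n * m ^ t) (sym m+d≡|M|) large) ⟩
      (m + d) C s
        ≡⟨ cong (_C s) m+d≡|M| ⟩
      length M C s
        ≡⟨ length-choose s M ⟨
      length (choose s M) ∎
      where
      bichromatic? = λ e → ¬? (lookup c (src e) Fin.≟ lookup c (tgt e))
      m = length (monochromatic (lookup c) M)
      d = count bichromatic? M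
      m+d≡|M| : m + d ≡ length M
      m+d≡|M| = count-∁ (λ e → lookup c (src e) Fin.≟ lookup c (tgt e)) M
      0^t≡0 : ∀ t .{{_ : NonZero t}} → 0 ^ t ≡ 0
      0^t≡0 (suc _) = refl
      -- If m were 0, the right side of `large` would be 0, because 0^t = 0 for t ≥ 1.
      m≢0 : NonZero m
      m≢0 = ≢-nonZero λ m≡0 → n≮0 (subst (length M ^ t <_)
        (trans (cong (λ k → n * k ^ t) m≡0) (trans (cong (n *_) (0^t≡0 t)) (*-zeroʳ n))) large)

    -- The n^n maps of the union bound cancel against (16n)^n = 16^n · n^n.
    count-stalls : ∀ M κ → count (stalls? M κ) (choose s M) * 16 ^ n ≤ length (choose s M)
    count-stalls M κ = *-cancelʳ-≤ _ _ (n ^ n) {{m^n≢0 n n {{>-nonZero (≤-trans (m^n>0 2 c) 2^c≤n)}}}} (begin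
      count (stalls? M κ) Hs * 16 ^ n * n ^ n
        ≡⟨ *-assoc (count (stalls? M κ) Hs) (16 ^ n) (n ^ n) ⟩
      count (stalls? M κ) Hs * (16 ^ n * n ^ n)
        ≡⟨ cong (count (stalls? M κ) Hs *_) (^-distribʳ-* n 16 n) ⟨
      count (stalls? M κ) Hs * (16 * n) ^ n
        ≤⟨ *-monoˡ-≤ ((16 * n) ^ n) (count-⊆ (stalls? M κ) _ (stalls⇒fooled M κ) Hs) ⟩
      count (λ H → any? (λ c → fooled? M c H) (colorings n n)) Hs * (16 * n) ^ n
        ≤⟨ union-bound (fooled? M) Hs (count-fooled M) (colorings n n) ⟩
      length (colorings n n) * length Hs
        ≡⟨ cong (_* length Hs) (length-colorings n n) ⟩
      n ^ n * length Hs
        ≡⟨ *-comm (n ^ n) (length Hs) ⟩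
      length Hs * n ^ n ∎)
      where Hs = choose s M

-- Naturals as rationals

ι : ℕ → ℚ
ι m = ℤ.+ m ℚ./ 1

ι≃ : ∀ m → toℚᵘ (ι m) ℚᵘ.≃ mkℚᵘ (ℤ.+ m) 0
ι≃ m = ℚ.toℚᵘ-fromℚᵘ (mkℚᵘ (ℤ.+ m) 0)

ι-+ : ∀ a b → ι (a + b) ≡ ι a ℚ.+ ι b
ι-+ a b = ℚ.toℚᵘ-injective (begin
  toℚᵘ (ι (a + b))                ≈⟨ ι≃ (a + b) ⟩
  mkℚᵘ (ℤ.+ (a + b)) 0              ≈⟨ *≡* (cong (ℤ._* ℤ.+ 1) (cong₂ ℤ._+_ (ℤ.*-identityʳ (ℤ.+ a)) (ℤ.*-identityʳ (ℤ.+ b)))) ⟨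
  mkℚᵘ (ℤ.+ a) 0 ℚᵘ.+ mkℚᵘ (ℤ.+ b) 0  ≈⟨ ℚᵘ.+-cong (ι≃ a) (ι≃ b) ⟨
  toℚᵘ (ι a) ℚᵘ.+ toℚᵘ (ι b)      ≈⟨ ℚ.toℚᵘ-homo-+ (ι a) (ι b) ⟨
  toℚᵘ (ι a ℚ.+ ι b)              ∎)
  where open ℚᵘ.≃-Reasoning

ι-* : ∀ a b → ι (a * b) ≡ ι a ℚ.* ι b
ι-* a b = ℚ.toℚᵘ-injective (begin
  toℚᵘ (ι (a * b))                ≈⟨ ι≃ (a * b) ⟩
  mkℚᵘ (ℤ.+ (a * b)) 0              ≈⟨ *≡* (cong (ℤ._* ℤ.+ 1) (ℤ.pos-* a b)) ⟩
  mkℚᵘ (ℤ.+ a) 0 ℚᵘ.* mkℚᵘ (ℤ.+ b) 0  ≈⟨ ℚᵘ.*-cong (ι≃ a) (ι≃ b) ⟨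
  toℚᵘ (ι a) ℚᵘ.* toℚᵘ (ι b)      ≈⟨ ℚ.toℚᵘ-homo-* (ι a) (ι b) ⟨
  toℚᵘ (ι a ℚ.* ι b)              ∎)
  where open ℚᵘ.≃-Reasoning

ι-mono : ∀ {a b} → a ≤ b → ι a ℚ.≤ ι b
ι-mono {a} {b} a≤b = ℚ.toℚᵘ-cancel-≤ (begin
  toℚᵘ (ι a)    ≃⟨ ι≃ a ⟩
  mkℚᵘ (ℤ.+ a) 0  ≤⟨ *≤* (ℤ.*-monoʳ-≤-nonNeg (ℤ.+ 1) (ℤ.+≤+ a≤b)) ⟩
  mkℚᵘ (ℤ.+ b) 0  ≃⟨ ι≃ b ⟨
  toℚᵘ (ι b)    ∎)
  where open ℚᵘ.≤-Reasoning

1/n*n≡1 : ∀ n → (ℤ.+ 1 ℚ./ suc n) ℚ.* ι (suc n) ≡ 1ℚ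
1/n*n≡1 n = ℚ.toℚᵘ-injective (begin
  toℚᵘ ((ℤ.+ 1 ℚ./ suc n) ℚ.* ι (suc n))         ≈⟨ ℚ.toℚᵘ-homo-* (ℤ.+ 1 ℚ./ suc n) (ι (suc n)) ⟩
  toℚᵘ (ℤ.+ 1 ℚ./ suc n) ℚᵘ.* toℚᵘ (ι (suc n))   ≈⟨ ℚᵘ.*-cong (ℚ.toℚᵘ-fromℚᵘ (mkℚᵘ (ℤ.+ 1) n)) (ι≃ (suc n)) ⟩
  mkℚᵘ (ℤ.+ 1) n ℚᵘ.* mkℚᵘ (ℤ.+ suc n) 0           ≈⟨ *≡* (cong ℤ.+_ (eq n)) ⟩
  mkℚᵘ (ℤ.+ 1) 0                                 ∎)
  where
  open ℚᵘ.≃-Reasoning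
  eq : ∀ n → (suc n + 0) * 1 ≡ 1 * (suc n * 1)
  eq = solve-∀

ι-nonNeg : ∀ m → ℚ.NonNegative (ι m)
ι-nonNeg m = ℚ.normalize-nonNeg m 1

-- Expectations

𝔼 : (A → ℚ) → Dist A → ℚ
𝔼 f []            = 0ℚ
𝔼 f ((p , a) ∷ d) = p ℚ.* f a ℚ.+ 𝔼 f d

NonNegativeDist : Pred (Dist A) 0ℓ
NonNegativeDist = All (λ pa → ℚ.NonNegative (proj₁ pa))

𝔼-++ : ∀ (f : A → ℚ) d e → 𝔼 f (d ++ e) ≡ 𝔼 f d ℚ.+ 𝔼 f e
𝔼-++ f []            e = sym (ℚ.+-identityˡ (𝔼 f e))
𝔼-++ f ((p , a) ∷ d) e = trans (cong (p ℚ.* f a ℚ.+_) (𝔼-++ f d e)) (sym (ℚ.+-assoc (p ℚ.* f a) (𝔼 f d) (𝔼 f e)))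

𝔼-scale : ∀ (f : A → ℚ) q d → q ℚ.* 𝔼 f d ≡ 𝔼 (λ a → q ℚ.* f a) d
𝔼-scale f q []            = ℚ.*-zeroʳ q
𝔼-scale f q ((p , a) ∷ d) = begin
  q ℚ.* (p ℚ.* f a ℚ.+ 𝔼 f d)           ≡⟨ eq q p (f a) (𝔼 f d) ⟩
  p ℚ.* (q ℚ.* f a) ℚ.+ q ℚ.* 𝔼 f d     ≡⟨ cong (p ℚ.* (q ℚ.* f a) ℚ.+_) (𝔼-scale f q d) ⟩
  p ℚ.* (q ℚ.* f a) ℚ.+ 𝔼 (λ a → q ℚ.* f a) d ∎
  where
  open ≡-Reasoning
  open +-*-Solver
  eq : ∀ q p x y → q ℚ.* (p ℚ.* x ℚ.+ y) ≡ p ℚ.* (q ℚ.* x) ℚ.+ q ℚ.* y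
  eq = solve 4 (λ q p x y → q :* (p :* x :+ y) := p :* (q :* x) :+ q :* y) refl

𝔼-+ : ∀ (f g : A → ℚ) d → 𝔼 (λ a → f a ℚ.+ g a) d ≡ 𝔼 f d ℚ.+ 𝔼 g d
𝔼-+ f g []            = refl
𝔼-+ f g ((p , a) ∷ d) = begin
  p ℚ.* (f a ℚ.+ g a) ℚ.+ 𝔼 (λ a → f a ℚ.+ g a) d  ≡⟨ cong (p ℚ.* (f a ℚ.+ g a) ℚ.+_) (𝔼-+ f g d) ⟩
  p ℚ.* (f a ℚ.+ g a) ℚ.+ (𝔼 f d ℚ.+ 𝔼 g d)        ≡⟨ eq p (f a) (g a) (𝔼 f d) (𝔼 g d) ⟩
  p ℚ.* f a ℚ.+ 𝔼 f d ℚ.+ (p ℚ.* g a ℚ.+ 𝔼 g d)    ∎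
  where
  open ≡-Reasoning
  open +-*-Solver
  eq : ∀ p x y u v → p ℚ.* (x ℚ.+ y) ℚ.+ (u ℚ.+ v) ≡ p ℚ.* x ℚ.+ u ℚ.+ (p ℚ.* y ℚ.+ v)
  eq = solve 5 (λ p x y u v → p :* (x :+ y) :+ (u :+ v) := p :* x :+ u :+ (p :* y :+ v)) refl

𝔼-cong : ∀ {f g : A → ℚ} → (∀ a → f a ≡ g a) → ∀ d → 𝔼 f d ≡ 𝔼 g d
𝔼-cong f≗g []            = refl
𝔼-cong f≗g ((p , a) ∷ d) = cong₂ (λ x y → p ℚ.* x ℚ.+ y) (f≗g a) (𝔼-cong f≗g d)

𝔼-mono : ∀ {f g : A → ℚ} {d} → NonNegativeDist d → (∀ a → f a ℚ.≤ g a) → 𝔼 f d ℚ.≤ 𝔼 g d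
𝔼-mono []                         f≤g = ℚ.≤-refl
𝔼-mono {d = (p , a) ∷ _} (p≥0 ∷ d≥0) f≤g =
  ℚ.+-mono-≤ (ℚ.*-monoˡ-≤-nonNeg p {{p≥0}} (f≤g a)) (𝔼-mono d≥0 f≤g)

-- `h` is given only through its values, so that the lemma applies to the pattern-matching lambda
-- inside `>>=`.
𝔼-reweigh : ∀ (f : A → ℚ) p (h : ℚ × A → ℚ × A) → (∀ q a → h (q , a) ≡ (p ℚ.* q , a)) →
            ∀ d → 𝔼 f (map h d) ≡ p ℚ.* 𝔼 f d
𝔼-reweigh f p h h≗ []            = sym (ℚ.*-zeroʳ p)
𝔼-reweigh f p h h≗ ((q , a) ∷ d) rewrite h≗ q a | 𝔼-reweigh f p h h≗ d = eq p q (f a) (𝔼 f d)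
  where
  open +-*-Solver
  eq : ∀ p q x y → p ℚ.* q ℚ.* x ℚ.+ p ℚ.* y ≡ p ℚ.* (q ℚ.* x ℚ.+ y)
  eq = solve 4 (λ p q x y → p :* q :* x :+ p :* y := p :* (q :* x :+ y)) refl

𝔼->>= : ∀ (f : B → ℚ) (d : Dist A) (k : A → Dist B) → 𝔼 f (d >>= k) ≡ 𝔼 (λ a → 𝔼 f (k a)) d
𝔼->>= f []            k = refl
𝔼->>= f ((p , a) ∷ d) k =
  trans (𝔼-++ f (map _ (k a)) (d >>= k))
        (cong₂ ℚ._+_ (𝔼-reweigh f p _ (λ _ _ → refl) (k a)) (𝔼->>= f d k))

𝔼-pure : ∀ (f : A → ℚ) a → 𝔼 f (pure a) ≡ f a
𝔼-pure f a = trans (ℚ.+-identityʳ (1ℚ ℚ.* f a)) (ℚ.*-identityˡ (f a))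

𝔼-fmap : ∀ (f : B → ℚ) (g : A → B) d → 𝔼 f (d >>= λ a → pure (g a)) ≡ 𝔼 (λ a → f (g a)) d
𝔼-fmap f g d = trans (𝔼->>= f d (λ a → pure (g a))) (𝔼-cong (λ a → 𝔼-pure f (g a)) d)

uniform-nonNeg : (xs : List A) → NonNegativeDist (uniform xs)
uniform-nonNeg []         = []
uniform-nonNeg xs@(_ ∷ _) = All.map⁺ (All.universal (λ _ → ℚ.normalize-nonNeg 1 (length xs)) xs)

>>=-nonNeg : ∀ {d : Dist A} {k : A → Dist B} → NonNegativeDist d → (∀ a → NonNegativeDist (k a)) →
             NonNegativeDist (d >>= k)
>>=-nonNeg []            k≥0 = []
>>=-nonNeg {d = (p , a) ∷ d} (p≥0 ∷ d≥0) k≥0 =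
  All.++⁺ (All.map⁺ (All.map (λ {qb} q≥0 → ℚ.nonNeg*nonNeg⇒nonNeg p {{p≥0}} (proj₁ qb) {{q≥0}}) (k≥0 a)))
          (>>=-nonNeg d≥0 k≥0)

-- Reduces an average over samples to a sum of naturals: w bounds f from above, and the weights 1 /
-- length xs turn the total b * length xs into b.
𝔼-uniform : ∀ (f : A → ℚ) (w : A → ℕ) b xs → .{{NonZero (length xs)}} →
            All (λ x → f x ℚ.≤ ι (w x)) xs → sum (map w xs) ≤ b * length xs →
            𝔼 f (uniform xs) ℚ.≤ ι b
𝔼-uniform f w b xs@(_ ∷ xs′) f≤w Σw≤b = begin
  𝔼 f (uniform xs)                ≤⟨ weighted xs f≤w ⟩
  q ℚ.* ι (sum (map w xs))        ≤⟨ ℚ.*-monoˡ-≤-nonNeg q {{q≥0}} (ι-mono Σw≤b) ⟩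
  q ℚ.* ι (b * length xs)         ≡⟨ cong (q ℚ.*_) (ι-* b (length xs)) ⟩
  q ℚ.* (ι b ℚ.* ι (length xs))   ≡⟨ eq q (ι b) (ι (length xs)) ⟩
  q ℚ.* ι (length xs) ℚ.* ι b     ≡⟨ cong (ℚ._* ι b) (1/n*n≡1 (length xs′)) ⟩
  1ℚ ℚ.* ι b                      ≡⟨ ℚ.*-identityˡ (ι b) ⟩
  ι b                             ∎
  where
  open ℚ.≤-Reasoning
  q = ℤ.+ 1 ℚ./ length xs
  q≥0 = ℚ.normalize-nonNeg 1 (length xs)
  eq : ∀ q x y → q ℚ.* (x ℚ.* y) ≡ q ℚ.* y ℚ.* x
  eq = solve 3 (λ q x y → q :* (x :* y) := q :* y :* x) refl
    where open +-*-Solver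
  weighted : ∀ ys → All (λ x → f x ℚ.≤ ι (w x)) ys → 𝔼 f (map (λ x → q , x) ys) ℚ.≤ q ℚ.* ι (sum (map w ys))
  weighted []       []         = ℚ.≤-reflexive (sym (ℚ.*-zeroʳ q))
  weighted (y ∷ ys) (le ∷ les) = begin
    q ℚ.* f y ℚ.+ 𝔼 f (map (λ x → q , x) ys)        ≤⟨ ℚ.+-mono-≤ (ℚ.*-monoˡ-≤-nonNeg q {{q≥0}} le) (weighted ys les) ⟩
    q ℚ.* ι (w y) ℚ.+ q ℚ.* ι (sum (map w ys))      ≡⟨ ℚ.*-distribˡ-+ q (ι (w y)) (ι (sum (map w ys))) ⟨
    q ℚ.* (ι (w y) ℚ.+ ι (sum (map w ys)))          ≡⟨ cong (q ℚ.*_) (ι-+ (w y) (sum (map w ys))) ⟨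
    q ℚ.* ι (w y + sum (map w ys))                  ∎

𝔼-uniform-const : ∀ (q : ℚ) (xs : List A) → .{{NonZero (length xs)}} → 𝔼 (λ _ → q) (uniform xs) ≡ q
𝔼-uniform-const q xs@(_ ∷ xs′) = begin
  𝔼 (λ _ → q) (uniform xs)          ≡⟨ weighted xs ⟩
  r ℚ.* ι (length xs) ℚ.* q         ≡⟨ cong (ℚ._* q) (1/n*n≡1 (length xs′)) ⟩
  1ℚ ℚ.* q                          ≡⟨ ℚ.*-identityˡ q ⟩
  q                                 ∎
  where
  open ≡-Reasoning
  r = ℤ.+ 1 ℚ./ length xs
  eq : ∀ r q x → r ℚ.* q ℚ.+ r ℚ.* x ℚ.* q ≡ r ℚ.* (1ℚ ℚ.+ x) ℚ.* q
  eq = solve 3 (λ r q x → r :* q :+ r :* x :* q := r :* (con 1ℚ :+ x) :* q) refl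
    where open +-*-Solver
  weighted : ∀ ys → 𝔼 (λ _ → q) (map (λ x → r , x) ys) ≡ r ℚ.* ι (length ys) ℚ.* q
  weighted []       = sym (trans (cong (ℚ._* q) (ℚ.*-zeroʳ r)) (ℚ.*-zeroˡ q))
  weighted (y ∷ ys) = begin
    r ℚ.* q ℚ.+ 𝔼 (λ _ → q) (map (λ x → r , x) ys)  ≡⟨ cong (r ℚ.* q ℚ.+_) (weighted ys) ⟩
    r ℚ.* q ℚ.+ r ℚ.* ι (length ys) ℚ.* q           ≡⟨ eq r q (ι (length ys)) ⟩
    r ℚ.* (1ℚ ℚ.+ ι (length ys)) ℚ.* q              ≡⟨ cong (λ x → r ℚ.* x ℚ.* q) (ι-+ 1 (length ys)) ⟨
    r ℚ.* ι (suc (length ys)) ℚ.* q                 ∎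

-- Indicators and complements

𝟏 : {P : Set} → Dec P → ℕ
𝟏 P? = if does P? then 1 else 0

𝟏-⊎ : {P Q R : Set} (P? : Dec P) (Q? : Dec Q) (R? : Dec R) → (¬ Q → ¬ R → ¬ P) → 𝟏 P? ≤ 𝟏 Q? + 𝟏 R?
𝟏-⊎ (no _)  Q?       R?      f = z≤n
𝟏-⊎ (yes p) (yes _)  R?      f = s≤s z≤n
𝟏-⊎ (yes p) (no _)   (yes _) f = ≤-refl
𝟏-⊎ (yes p) (no ¬q)  (no ¬r) f = contradiction p (f ¬q ¬r)

-- When P holds, one more indicator on the right makes up for the 1 by which m may exceed o. In the
-- application P is a stall and m the number of edges left.
𝟏-slack : {P : Set} (P? : Dec P) → ∀ k {m o} → (P → m ≤ suc o) → (¬ P → m ≤ o) →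
          k * 𝟏 P? + m ≤ suc k * 𝟏 P? + o
𝟏-slack (yes p) k {m} {o} m≤1+o _ = ≤-trans (+-monoʳ-≤ (k * 1) (m≤1+o p)) (≤-reflexive (+-suc (k * 1) o))
𝟏-slack (no ¬p) k         _ m≤o = +-monoʳ-≤ (k * 0) (m≤o ¬p)

-- The right side is the total weight, since a `Dist` need not be normalised; for the process it is
-- evaluated by `𝔼-head-rounds`.
Pr-∁ : {P : Pred A 0ℓ} (P? : Decidable P) → ∀ d →
       Pr P? d ℚ.+ 𝔼 (λ a → ι (𝟏 (¬? (P? a)))) d ≡ 𝔼 (λ _ → 1ℚ) d
Pr-∁ P? []            = refl
Pr-∁ P? ((p , a) ∷ d) = begin
  x ℚ.+ Pr P? d ℚ.+ (y ℚ.+ 𝔼 fail d)    ≡⟨ eq x (Pr P? d) y (𝔼 fail d) ⟩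
  x ℚ.+ y ℚ.+ (Pr P? d ℚ.+ 𝔼 fail d)    ≡⟨ cong₂ ℚ._+_ (split (does (P? a)) refl) (Pr-∁ P? d) ⟩
  p ℚ.* 1ℚ ℚ.+ 𝔼 (λ _ → 1ℚ) d           ∎
  where
  open ≡-Reasoning
  fail = λ a → ι (𝟏 (¬? (P? a)))
  x = if does (P? a) then p else 0ℚ
  y = p ℚ.* fail a
  eq : ∀ x u y v → x ℚ.+ u ℚ.+ (y ℚ.+ v) ≡ x ℚ.+ y ℚ.+ (u ℚ.+ v)
  eq = solve 4 (λ x u y v → x :+ u :+ (y :+ v) := x :+ y :+ (u :+ v)) refl
    where open +-*-Solver
  split : ∀ b → does (P? a) ≡ b → x ℚ.+ y ≡ p ℚ.* 1ℚ
  split true  eq rewrite eq =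
    trans (cong (p ℚ.+_) (ℚ.*-zeroʳ p)) (trans (ℚ.+-identityʳ p) (sym (ℚ.*-identityʳ p)))
  split false eq rewrite eq = ℚ.+-identityˡ (p ℚ.* 1ℚ)

sum-count : {P : Pred A 0ℓ} (P? : Decidable P) (w : A → ℕ) → ∀ a b →
            (∀ x → w x ≤ a * 𝟏 (P? x) + b) → ∀ xs → sum (map w xs) ≤ a * count P? xs + b * length xs
sum-count P? w a b w≤ [] = z≤n
sum-count P? w a b w≤ (x ∷ xs) with ih ← sum-count P? w a b w≤ xs | w≤x ← w≤ x | P? x
... | yes _ = ≤-trans (+-mono-≤ w≤x ih) (≤-reflexive (eq a b (count P? xs) (length xs)))
  where
  eq : ∀ a b c l → a * 1 + b + (a * c + b * l) ≡ a * suc c + b * suc l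
  eq = solve-∀
... | no  _ = ≤-trans (+-mono-≤ w≤x ih) (≤-reflexive (eq a b (count P? xs) (length xs)))
  where
  eq : ∀ a b c l → a * 0 + b + (a * c + b * l) ≡ a * c + b * suc l
  eq = solve-∀

n<2^n : ∀ n → n < 2 ^ n
n<2^n zero    = s≤s z≤n
n<2^n (suc n) = ≤-trans (+-mono-≤ (m^n>0 2 n) (n<2^n n))
  (≤-reflexive (cong (_+_ (2 ^ n)) (sym (+-identityʳ (2 ^ n)))))

choose-nonZero : ∀ {k} (xs : List A) → k ≤ length xs → NonZero (length (choose k xs))
choose-nonZero {k = zero}  xs       _           = _
choose-nonZero {k = suc k} (x ∷ xs) (s≤s k≤|xs|) = >-nonZero (begin-strict
  0                                     <⟨ >-nonZero⁻¹ _ {{choose-nonZero xs k≤|xs|}} ⟩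
  length (choose k xs)                  ≡⟨ length-map (x ∷_) (choose k xs) ⟨
  length (map (x ∷_) (choose k xs))     ≤⟨ length-++-≤ˡ (map (x ∷_) (choose k xs)) ⟩
  length (choose (suc k) (x ∷ xs))      ∎)
  where open ≤-Reasoning

-- Failure probability of the process, by induction on the rounds

module _ {n : ℕ} (t s : ℕ) (σ : Strategy n) where
  open OptimalColoring

  next : List (EdgeSet n) → EdgeSet n → EdgeSet n → EdgeSet n
  next past M H = monochromatic (color (σ past H)) M

  rounds-nonNeg : ∀ k past M → NonNegativeDist (rounds s σ k past M)
  rounds-nonNeg zero    past M = _ ∷ []
  rounds-nonNeg (suc k) past M = >>=-nonNeg (uniform-nonNeg (choose (s ⊓ length M) M)) λ H →
    >>=-nonNeg (rounds-nonNeg k (H ∷ past) (next past M H)) λ Ms → _ ∷ []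

  -- The first entry is always M and the total weight is 1. A constant f gives the total weight
  -- alone; the stall indicator as f splits the current round from the later ones.
  𝔼-head-rounds : ∀ (f : EdgeSet n → ℚ) k past M → 𝔼 (λ Ms → f (head Ms)) (rounds s σ k past M) ≡ f M
  𝔼-head-rounds f zero    past M = 𝔼-pure (λ Ms → f (head {n = 0} Ms)) (M ∷ [])
  𝔼-head-rounds f (suc k) past M = begin
    𝔼 (λ Ms → f (head Ms)) (rounds s σ (suc k) past M)
      ≡⟨ 𝔼->>= _ (sample s M) _ ⟩
    𝔼 (λ H → 𝔼 (λ Ms → f (head Ms)) (rest H >>= λ Ms → pure (M ∷ Ms))) (sample s M)
      ≡⟨ 𝔼-cong (λ H → trans (𝔼-fmap _ (M ∷_) (rest H))
                             (𝔼-head-rounds (λ _ → f M) k (H ∷ past) (next past M H))) (sample s M) ⟩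
    𝔼 (λ H → f M) (sample s M)
      ≡⟨ 𝔼-uniform-const (f M) (choose (s ⊓ length M) M) {{choose-nonZero M (m⊓n≤n s (length M))}} ⟩
    f M ∎
    where
    open ≡-Reasoning
    rest = λ H → rounds s σ k (H ∷ past) (next past M H)

  -- `AllShrink` with the number k of rounds detached from the exponent t, so that induction on k is
  -- possible; for k = t the two agree.
  Shrinks : ∀ k → Pred (Vec (EdgeSet n) (suc k)) 0ℓ
  Shrinks k Ms = ∀ (i : Fin k) → n * length (lookup Ms (suc i)) ^ t ≤ length (lookup Ms (inject₁ i)) ^ t

  shrinks? : ∀ k → Decidable (Shrinks k)
  shrinks? k Ms = Fin.all? λ i →
    n * length (lookup Ms (suc i)) ^ t ≤? length (lookup Ms (inject₁ i)) ^ t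

  fail : ∀ k → Vec (EdgeSet n) (suc k) → ℕ
  fail k Ms = 𝟏 (¬? (shrinks? k Ms))

  stall : EdgeSet n → EdgeSet n → ℕ
  stall M M′ = 𝟏 (length M ^ t <? n * length M′ ^ t)

  fail-∷ : ∀ k M Ms → fail (suc k) (M ∷ Ms) ≤ stall M (head Ms) + fail k Ms
  fail-∷ k M Ms@(M′ ∷ _) = 𝟏-⊎ (¬? (shrinks? (suc k) (M ∷ Ms))) (length M ^ t <? n * length M′ ^ t)
    (¬? (shrinks? k Ms))
    λ ¬stalls ¬¬shrinks ¬all → ¬¬shrinks λ shrinks → ¬all λ
      { zero → ≮⇒≥ ¬stalls ; (suc i) → shrinks i }

  module _ {c} (20≤c : 20 ≤ c) (2^c≤n : 2 ^ c ≤ n) (enough : EnoughSamples n t s)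
           .{{t≢0 : NonZero t}} where

    -- This is 8^n, split as it will be spent: 4^n covers the number of edges of G, and 2^n is the
    -- bound to be reached.
    K : ℕ
    K = 4 ^ n * 2 ^ n

    -- Since a round stalls with probability at most 16^(-n), a penalty of K + 1 for stalling costs
    -- at most 1 on average.
    1+K≤16^n : suc K ≤ 16 ^ n
    1+K≤16^n = begin
      1 + K                   ≤⟨ +-monoˡ-≤ K (*-mono-≤ (m^n>0 4 n) (m^n>0 2 n)) ⟩
      K + K                   ≡⟨ *-distribˡ-+ (4 ^ n) (2 ^ n) (2 ^ n) ⟨
      4 ^ n * (2 ^ n + 2 ^ n) ≤⟨ *-monoʳ-≤ (4 ^ n) 2^n+2^n≤4^n ⟩
      4 ^ n * 4 ^ n           ≡⟨ ^-distribʳ-* n 4 4 ⟨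
      16 ^ n                  ∎
      where
      open ≤-Reasoning
      2^n+2^n≤4^n : 2 ^ n + 2 ^ n ≤ 4 ^ n
      2^n+2^n≤4^n = begin
        2 ^ n + 2 ^ n   ≡⟨ cong (_+_ (2 ^ n)) (+-identityʳ (2 ^ n)) ⟨
        2 * 2 ^ n       ≤⟨ *-monoˡ-≤ (2 ^ n) (^-monoʳ-≤ 2 {1} {n} (≤-trans (m^n>0 2 c) 2^c≤n)) ⟩
        2 ^ n * 2 ^ n   ≡⟨ ^-distribʳ-* n 2 2 ⟨
        4 ^ n           ∎

    module _ (past : List (EdgeSet n)) (M : EdgeSet n) where
      -- A potential: the penalty K for a stall in this round plus the edges left, which will bound
      -- K times the failure probability of the later rounds.
      cost : EdgeSet n → ℕ
      cost H = K * stall M (next past M H) + length (next past M H)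

      -- Without a stall an edge is lost: |M′| ≥ |M| > 0 and n ≥ 2 would give n|M′|^t > |M|^t. With
      -- a stall |M′| may equal |M|, one more than `pred (length M)`, hence the coefficient `suc K`.
      cost-bound : 0 < length M → ∀ H → cost H ≤ suc K * stall M (next past M H) + pred (length M)
      cost-bound |M|>0 H = 𝟏-slack (length M ^ t <? n * length M′ ^ t) K
        (λ _ → ≤-trans (length-filter _ M) (≤-reflexive (sym (suc-pred (length M) {{>-nonZero |M|>0}}))))
        (λ ¬stalls → <⇒≤pred (|M′|<|M| ¬stalls))
        where
        open ≤-Reasoning
        M′ = next past M H
        2≤n : 2 ≤ n
        2≤n = ≤-trans (^-monoʳ-≤ 2 {1} {c} (≤-trans (s≤s z≤n) 20≤c)) 2^c≤n
        |M′|<|M| : ¬ (length M ^ t < n * length M′ ^ t) → length M′ < length M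
        |M′|<|M| ¬stalls = ≰⇒> λ |M|≤|M′| → ¬stalls (begin-strict
          length M ^ t        <⟨ m<m*n (length M ^ t) n {{m^n≢0 (length M) t {{>-nonZero |M|>0}}}} 2≤n ⟩
          length M ^ t * n    ≡⟨ *-comm (length M ^ t) n ⟩
          n * length M ^ t    ≤⟨ *-monoʳ-≤ n (^-monoˡ-≤ t |M|≤|M′|) ⟩
          n * length M′ ^ t   ∎)

      -- The average cost is at most |M|: the expected penalty of at most 1 is balanced by the edge
      -- that is lost otherwise.
      total-cost : sum (map cost (choose (s ⊓ length M) M)) ≤
                   length M * length (choose (s ⊓ length M) M)
      total-cost with length M ≤? s
      -- The only sample is M itself, and a coloring proper on M leaves no edge, so the cost is 0.
      -- An empty M falls under this case, so M has an edge in the other one.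
      ... | yes |M|≤s rewrite m≥n⇒m⊓n≡n |M|≤s | choose-length M = begin
        cost M + 0              ≡⟨ cong (λ M′ → K * stall M M′ + length M′ + 0) next≡[] ⟩
        K * stall M [] + 0 + 0  ≡⟨ cong (λ k → K * k + 0 + 0) (stall-[] t) ⟩
        K * 0 + 0 + 0           ≡⟨ cong (λ k → k + 0 + 0) (*-zeroʳ K) ⟩
        0                       ≤⟨ z≤n ⟩
        length M * 1            ∎
        where
        open ≤-Reasoning
        next≡[] : next past M M ≡ []
        next≡[] = filter-none _ (proper (σ past M))
        stall-[] : ∀ t .{{_ : NonZero t}} → 𝟏 (length M ^ t <? n * 0 ^ t) ≡ 0
        stall-[] (suc t) rewrite *-zeroʳ n = refl
      ... | no |M|≰s rewrite m≤n⇒m⊓n≡m (<⇒≤ (≰⇒> |M|≰s)) = begin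
        sum (map cost Hs)
          ≤⟨ sum-count stalls-M? cost (suc K) (pred (length M)) (cost-bound |M|>0) Hs ⟩
        suc K * count stalls-M? Hs + pred (length M) * length Hs
          ≤⟨ +-monoˡ-≤ _ few ⟩
        suc (pred (length M)) * length Hs
          ≡⟨ cong (_* length Hs) (suc-pred (length M) {{>-nonZero |M|>0}}) ⟩
        length M * length Hs ∎
        where
        open ≤-Reasoning
        Hs = choose s M
        |M|>0 : 0 < length M
        |M|>0 = m<n⇒0<n (≰⇒> |M|≰s)
        stalls-M? : Decidable (Stalls {n} {t} M (σ past))
        stalls-M? = stalls? {n} {t} M (σ past)
        few : suc K * count stalls-M? Hs ≤ length Hs
        few = begin
          suc K * count stalls-M? Hs    ≤⟨ *-monoˡ-≤ _ 1+K≤16^n ⟩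
          16 ^ n * count stalls-M? Hs   ≡⟨ *-comm (16 ^ n) _ ⟩
          count stalls-M? Hs * 16 ^ n   ≤⟨ count-stalls {n} {t} {s} 20≤c 2^c≤n enough M (σ past) ⟩
          length Hs                    ∎

    -- The right side is free of k, so the number of rounds does not enter. Given H, the current
    -- round contributes `K * stall M M′` and the later rounds at most |M′| by induction; together
    -- this is `cost`, whose average `total-cost` bounds.
    fail-bound : ∀ k past M → ι K ℚ.* 𝔼 (λ Ms → ι (fail k Ms)) (rounds s σ k past M) ℚ.≤ ι (length M)
    fail-bound zero    past M = ℚ.≤-trans (ℚ.≤-reflexive (ℚ.*-zeroʳ (ι K))) (ι-mono {0} {length M} z≤n)
    fail-bound (suc k) past M = begin
      ι K ℚ.* 𝔼 F (rounds s σ (suc k) past M)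
        ≡⟨ cong (ι K ℚ.*_) (𝔼->>= F (sample s M) _) ⟩
      ι K ℚ.* 𝔼 (λ H → 𝔼 F (rest H >>= λ Ms → pure (M ∷ Ms))) (sample s M)
        ≡⟨ 𝔼-scale _ (ι K) (sample s M) ⟩
      𝔼 (λ H → ι K ℚ.* 𝔼 F (rest H >>= λ Ms → pure (M ∷ Ms))) (sample s M)
        ≤⟨ 𝔼-uniform _ (cost past M) (length M) Hs {{choose-nonZero M (m⊓n≤n s (length M))}}
             (All.universal after Hs) (total-cost past M) ⟩
      ι (length M) ∎
      where
      open ℚ.≤-Reasoning
      F = λ Ms → ι (fail (suc k) Ms)
      Hs = choose (s ⊓ length M) M
      rest = λ H → rounds s σ k (H ∷ past) (next past M H)
      after : ∀ H → ι K ℚ.* 𝔼 F (rest H >>= λ Ms → pure (M ∷ Ms)) ℚ.≤ ι (cost past M H)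
      after H = begin
        ι K ℚ.* 𝔼 F (rest H >>= λ Ms → pure (M ∷ Ms))
          ≡⟨ cong (ι K ℚ.*_) (𝔼-fmap F (M ∷_) (rest H)) ⟩
        ι K ℚ.* 𝔼 (λ Ms → F (M ∷ Ms)) (rest H)
          ≤⟨ ℚ.*-monoˡ-≤-nonNeg (ι K) {{ι-nonNeg K}} (𝔼-mono (rounds-nonNeg k (H ∷ past) M′) (λ Ms →
               ℚ.≤-trans (ι-mono (fail-∷ k M Ms)) (ℚ.≤-reflexive (ι-+ (stall M (head Ms)) (fail k Ms))))) ⟩
        ι K ℚ.* 𝔼 (λ Ms → ι (stall M (head Ms)) ℚ.+ ι (fail k Ms)) (rest H)
          ≡⟨ cong (ι K ℚ.*_) (𝔼-+ _ _ (rest H)) ⟩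
        ι K ℚ.* (𝔼 (λ Ms → ι (stall M (head Ms))) (rest H) ℚ.+ 𝔼 (λ Ms → ι (fail k Ms)) (rest H))
          ≡⟨ cong (λ x → ι K ℚ.* (x ℚ.+ 𝔼 (λ Ms → ι (fail k Ms)) (rest H)))
                  (𝔼-head-rounds (λ M′ → ι (stall M M′)) k (H ∷ past) M′) ⟩
        ι K ℚ.* (ι (stall M M′) ℚ.+ 𝔼 (λ Ms → ι (fail k Ms)) (rest H))
          ≡⟨ ℚ.*-distribˡ-+ (ι K) (ι (stall M M′)) _ ⟩
        ι K ℚ.* ι (stall M M′) ℚ.+ ι K ℚ.* 𝔼 (λ Ms → ι (fail k Ms)) (rest H)
          ≤⟨ ℚ.+-mono-≤ (ℚ.≤-reflexive (sym (ι-* K (stall M M′)))) (fail-bound k (H ∷ past) M′) ⟩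
        ι (K * stall M M′) ℚ.+ ι (length M′)
          ≡⟨ ι-+ (K * stall M M′) (length M′) ⟨
        ι (cost past M H) ∎
        where M′ = next past M H

    -- Multiplied by 4^n, the claim becomes K · u ≤ 4^n for the failure probability u. It follows
    -- from `fail-bound` and |E| ≤ n² ≤ (2^n)² = 4^n.
    sparsification-bound : ∀ (G : Graph n) → Pr (allShrink? n t) (sparsification G t s σ) ≥1-2^-[ 1 / 1 ]· n
    sparsification-bound G = ℚ.*-cancelˡ-≤-pos (ι (4 ^ n)) {{4^n>0}} (begin
      ι (4 ^ n) ℚ.* ((1ℚ ℚ.- p) ℚ.* 1ℚ ℚ.* ι (2 ^ (1 * n)))
        ≡⟨ cong (λ m → ι (4 ^ n) ℚ.* ((1ℚ ℚ.- p) ℚ.* 1ℚ ℚ.* ι (2 ^ m))) (*-identityˡ n) ⟩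
      ι (4 ^ n) ℚ.* ((1ℚ ℚ.- p) ℚ.* 1ℚ ℚ.* ι (2 ^ n))
        ≡⟨ cong (λ u → ι (4 ^ n) ℚ.* (u ℚ.* 1ℚ ℚ.* ι (2 ^ n))) 1-p≡u ⟩
      ι (4 ^ n) ℚ.* (u ℚ.* 1ℚ ℚ.* ι (2 ^ n))
        ≡⟨ eq (ι (4 ^ n)) u (ι (2 ^ n)) ⟩
      ι (4 ^ n) ℚ.* ι (2 ^ n) ℚ.* u
        ≡⟨ cong (ℚ._* u) (ι-* (4 ^ n) (2 ^ n)) ⟨
      ι K ℚ.* u
        ≤⟨ fail-bound t [] (edges G) ⟩
      ι (length (edges G))
        ≤⟨ ι-mono |E|≤4^n ⟩
      ι (4 ^ n)
        ≡⟨ ℚ.*-identityʳ (ι (4 ^ n)) ⟨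
      ι (4 ^ n) ℚ.* 1ℚ ∎)
      where
      open ℚ.≤-Reasoning
      d = sparsification G t s σ
      p = Pr (allShrink? n t) d
      u = 𝔼 (λ Ms → ι (fail t Ms)) d
      p+u≡1 : p ℚ.+ u ≡ 1ℚ
      p+u≡1 = trans (Pr-∁ (allShrink? n t) d) (𝔼-head-rounds (λ _ → 1ℚ) t [] (edges G))
      1-p≡u : 1ℚ ℚ.- p ≡ u
      1-p≡u = trans (cong (ℚ._- p) (sym p+u≡1)) (cancel p u)
        where
        open +-*-Solver
        cancel : ∀ p u → p ℚ.+ u ℚ.- p ≡ u
        cancel = solve 2 (λ p u → p :+ u :- p := u) refl
      eq : ∀ x u y → x ℚ.* (u ℚ.* 1ℚ ℚ.* y) ≡ x ℚ.* y ℚ.* u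
      eq = solve 3 (λ x u y → x :* (u :* con 1ℚ :* y) := x :* y :* u) refl
        where open +-*-Solver
      |E|≤4^n : length (edges G) ≤ 4 ^ n
      |E|≤4^n = ≤-trans (length-edges G) (≤-trans (*-mono-≤ (<⇒≤ (n<2^n n)) (<⇒≤ (n<2^n n)))
                  (≤-reflexive (sym (^-distribʳ-* n 2 2))))
      4^n>0 : ℚ.Positive (ι (4 ^ n))
      4^n>0 = ℚ.normalize-pos (4 ^ n) 1 {{_}} {{m^n≢0 4 n}}

claim7p3 : ∃[ a ] ∃[ b ] ∃[ n₀ ] (NonZero a × NonZero b ×
    (∀ (n : ℕ) → n₀ ≤ n → (t : ℕ) → 2 ≤ t →
    (G : Graph n) (s : ℕ) → IsSampleSize n t s → (σ : Strategy n) →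
    Pr (allShrink? n t) (sparsification G t s σ) ≥1-2^-[ a / b ]· n))
-- With a = b = 1 the failure probability is at most 2^(-n); the threshold is 2^c for c = 20.
claim7p3 = 1 , 1 , 2 ^ 20 , _ , _ , λ n n₀≤n t 2≤t G s (enough , _) σ →
  sparsification-bound t s σ {20} ≤-refl n₀≤n enough {{>-nonZero (≤-trans (n≤1+n 1) 2≤t)}} G
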